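{- Let $q\ge2$ be an integer and set $r=1$, $C=2q$. There exists a real $\varepsilon\in(0,1)$ such that the following hold. Let $G$ be a $1$-uniform hypergraph on $n$ vertices with $\delta(G)\ge(1-\varepsilon)n$, let $X$ be a spanning subhypergraph of $G$ with $\Delta(X)\le\frac nC$, and let $\Delta:=\max\{\Delta(X),\log n\}$. Then (a) there exists a $C$-refined $K_q^1$-omni-absorber $A\subseteq G$ for $X$ with $\Delta(A)\le C\cdot\Delta$; and (b) there exists a $C$-refined $K_q^1$-refiner $R\subseteq G$ of $X$ with refinement family $\mathcal H$ such that $\Delta(\mathcal H)\le C\cdot\Delta$.
   Context: A $1$-uniform hypergraph $G$ has a vertex set $V(G)$ and a set of $1$-element subsets ("singletons") as edges; we identify $G$ with its edge set. For $r=1$, the $(r-1)$-degree notions concern the empty set: $\Delta(G)=\delta(G)=$ the number of edges of $G$. A spanning subhypergraph $X$ of $G$ has $V(X)=V(G)$ and $E(X)\subseteq E(G)$; $A\subseteq G$ means $E(A)\subseteq E(G)$. $K_q^1$ is the $1$-uniform hypergraph consisting of $q$ singletons. A $1$-uniform hypergraph $L$ is $K_q^1$-divisible if $q$ divides its number of edges. $A$ is a $K_q^1$-omni-absorber for $X$ with decomposition family $\mathcal H$ if $V(X)=V(A)$, $X$ and $A$ are edge-disjoint, $\mathcal H$ is a family of subgraphs of $X\cup A$ each isomorphic to $K_q^1$ with $|H\cap X|\le1$ for all $H\in\mathcal H$, and for every $K_q^1$-divisible subgraph $L\subseteq X$ some pairwise edge-disjoint subfamily of $\mathcal H$ has union $L\cup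 A$; it is $C$-refined if each edge of $X\cup A$ lies in at most $C$ members of $\mathcal H$. $R$ is a $K_q^1$-refiner of $X$ with refinement family $\mathcal H$ if $V(X)=V(R)$, $X,R$ are edge-disjoint, $\mathcal H$ is a family of $K_q^1$-divisible subgraphs of $X\cup R$ with $|H\cap X|\le1$ for all $H$, and for every $K_q^1$-divisible $L\subseteq X$ some pairwise edge-disjoint subfamily of $\mathcal H$ has union $L\cup R$; $R$ is $C$-refined if each edge of $X\cup R$ lies in at most $C$ members of $\mathcal H$ and every $H\in\mathcal H$ has at most $C$ vertices and at most $C$ edges. Here $\Delta(\mathcal H)=|\mathcal H|$ (the number of members containing the empty set). -}

module Defs where

open import Data.Nat using (ℕ; zero; suc; _+_; _*_; _^_; _≤_; _<_; _!; _/_)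
open import Data.Nat.Properties using (_!≢0)
open import Data.Nat.Divisibility using (_∣_)
open import Data.Fin using (Fin)
open import Data.Fin.Subset using (Subset; _∈_; _⊆_; _∪_; _∩_; ∣_∣; Empty)
open import Data.Vec using (tabulate; lookup)
open import Data.List using (upTo; map)
open import Data.Nat.ListAction using (sum)
open import Data.Product using (Σ; ∃; _×_; _,_)
open import Data.Sum using (_⊎_)
open import Relation.Binary.PropositionalEquality using (_≡_; _≢_)
open import Function.Bundles using (_⇔_)

-- The edges of a 1-uniform hypergraph are singletons {v}; we encode the
-- edge set by the set of vertices v with {v} an edge, i.e. a Subset n.
-- Spanning subhypergraphs all share the vertex set Fin n.

Hyp1 : ℕ → Set
Hyp1 n = Subset n

-- For r = 1: Δ(G) = δ(G) = number of edges.
Δ₁ : ∀ {n} → Hyp1 n → ℕ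
Δ₁ G = ∣ G ∣

δ₁ : ∀ {n} → Hyp1 n → ℕ
δ₁ G = ∣ G ∣

IsKq1 : ∀ {n} → ℕ → Hyp1 n → Set
IsKq1 q H = ∣ H ∣ ≡ q

Divisible : ∀ {n} → ℕ → Hyp1 n → Set
Divisible q L = q ∣ ∣ L ∣

EdgeDisjoint : ∀ {n} → Hyp1 n → Hyp1 n → Set
EdgeDisjoint A B = Empty (A ∩ B)

Family : ℕ → ℕ → Set
Family n m = Fin m → Hyp1 n

membersAt : ∀ {n m} → Family n m → Fin n → Subset m
membersAt 𝓗 v = tabulate (λ i → lookup (𝓗 i) v)

DecomposesAs : ∀ {n m} → Family n m → Subset m → Hyp1 n → Set
DecomposesAs 𝓗 S K =
  (∀ i j → i ∈ S → j ∈ S → i ≢ j → EdgeDisjoint (𝓗 i) (𝓗 j)) ×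
  (∀ v → (v ∈ K) ⇔ (∃ λ i → i ∈ S × v ∈ 𝓗 i))

EdgeRefined : ∀ {n m} → ℕ → Family n m → Hyp1 n → Set
EdgeRefined C 𝓗 K = ∀ v → v ∈ K → ∣ membersAt 𝓗 v ∣ ≤ C

-- A is a K_q^1-omni-absorber for X with decomposition family 𝓗.
-- (V(X) = V(A) holds automatically.)
IsOmniAbsorber : ∀ {n m} → ℕ → (X A : Hyp1 n) → Family n m → Set
IsOmniAbsorber q X A 𝓗 =
  EdgeDisjoint X A ×
  (∀ i → (𝓗 i ⊆ X ∪ A) × IsKq1 q (𝓗 i) × ∣ 𝓗 i ∩ X ∣ ≤ 1) ×
  (∀ L → L ⊆ X → Divisible q L → ∃ λ S → DecomposesAs 𝓗 S (L ∪ A))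

IsRefinedOmniAbsorber : ∀ {n m} → ℕ → ℕ → (X A : Hyp1 n) → Family n m → Set
IsRefinedOmniAbsorber C q X A 𝓗 =
  IsOmniAbsorber q X A 𝓗 × EdgeRefined C 𝓗 (X ∪ A)

IsRefiner : ∀ {n m} → ℕ → (X R : Hyp1 n) → Family n m → Set
IsRefiner q X R 𝓗 =
  EdgeDisjoint X R ×
  (∀ i → (𝓗 i ⊆ X ∪ R) × Divisible q (𝓗 i) × ∣ 𝓗 i ∩ X ∣ ≤ 1) ×
  (∀ L → L ⊆ X → Divisible q L → ∃ λ S → DecomposesAs 𝓗 S (L ∪ R))

-- The vertex set of a member H
-- (the vertices covered by its singleton edges) has exactly ∣ H ∣ elements,
-- so both conditions read ∣ H ∣ ≤ C.
IsRefinedRefiner : ∀ {n m} → ℕ → ℕ → (X R : Hyp1 n) → Family n m → Set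
IsRefinedRefiner C q X R 𝓗 =
  IsRefiner q X R 𝓗 × EdgeRefined C 𝓗 (X ∪ R) ×
  (∀ i → ∣ 𝓗 i ∣ ≤ C × ∣ 𝓗 i ∣ ≤ C)

-- Natural logarithm comparison without reals.
-- expTaylorScaled k m = m! · Σ_{j=0}^{m} k^j / j!   (exact, as j! ∣ m!)
expTaylorScaled : ℕ → ℕ → ℕ
expTaylorScaled k m =
  sum (map (λ j → k ^ j * _/_ (m !) (j !) {{j !≢0}}) (upTo (suc m)))

-- ExpLe k N  :⇔  e^k ≤ N  (the partial sums of the exponential series
-- increase to e^k, so e^k ≤ N iff every partial sum is ≤ N).
ExpLe : ℕ → ℕ → Set
ExpLe k N = ∀ m → expTaylorScaled k m ≤ N * (m !)

-- LeTimesLog C k n  :⇔  k ≤ C · ln n   (⇔ e^k ≤ n^C; false for n = 0,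
-- matching ln 0 = -∞).
LeTimesLog : ℕ → ℕ → ℕ → Set
LeTimesLog C k n = ExpLe k (n ^ C)

LeTimesMaxDegLog : ∀ {n} → ℕ → ℕ → Hyp1 n → Set
LeTimesMaxDegLog {n} C k X = (k ≤ C * Δ₁ X) ⊎ LeTimesLog C k n

{-# OPTIONS --safe #-}
module Submission where

-- Let k = |X| and place the absorber on q·k vertices of G ∖ X, the slots 0, …, qk − 1 (with
-- ε = 1/4 and q ≥ 2 there is room for them).  The decomposition family consists of the windows,
-- q consecutive slots, and the bridges, q − 1 consecutive slots t, …, t + q − 2 together with the
-- edge x_i of X for the unique i with t ≤ qi < t + q.  A slot lies in at most q windows and q
-- bridges and an edge of X in at most q bridges, whence C = 2q.
-- Given L ⊆ X with q ∣ |L|, scan x_0, x_1, … keeping the position s_i = qi − r_i, where r_i is the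
-- number of edges of L among x_0, …, x_{i−1} reduced mod q: an edge outside L is passed with the
-- window at s_i, an edge of L with the bridge at s_i, followed by the window at qi whenever r_i + 1
-- reaches q.  The chosen blocks tile the slots [0, s_k) and contain exactly the edges of L, and
-- s_k = qk because q divides |L|.  All members have q edges, so the same family is a 2q-refined
-- refiner, and both size bounds hold with Δ(X) in place of max{Δ(X), log n}.

open import Defs
open import Data.Bool.Base using (Bool; true; false; if_then_else_)
open import Data.Empty using (⊥; ⊥-elim)
open import Data.Fin.Base using (Fin; zero; suc; toℕ; fromℕ<; splitAt; join)
open import Data.Fin.Properties
  using (toℕ<n; toℕ-injective; toℕ-fromℕ<; fromℕ<-injective; fromℕ<-toℕ; injective⇒≤; suc-injective;
         splitAt-join; join-splitAt)
  renaming (_≟_ to _≟ᶠ_)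
open import Data.Fin.Subset using (Subset; _∈_; _∉_; _⊆_; _∪_; _∩_; _─_; ∣_∣; inside; outside)
open import Data.Fin.Subset.Properties using (drop-there; x∈p∪q⁺; x∈p∪q⁻; x∈p∩q⁻) renaming (_∈?_ to _∈ˢ?_)
open import Data.List.Base as List
  using (List; []; _∷_; _++_; length; lookup; applyUpTo; applyDownFrom; filter)
open import Data.List.Membership.Propositional using () renaming (_∈_ to _∈ₗ_)
open import Data.List.Membership.Propositional.Properties
  using (∈-lookup; ∈-++⁺ˡ; ∈-++⁺ʳ; ∈-++⁻; ∈-applyUpTo⁺; ∈-applyUpTo⁻; ∈-applyDownFrom⁺; ∈-tabulate⁺;
         ∈-tabulate⁻; ∈-filter⁺; ∈-filter⁻)
import Data.List.Membership.DecPropositional as DecMembership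
open import Data.List.Properties using (length-applyUpTo; length-tabulate)
import Data.List.Relation.Unary.All as All
open import Data.List.Relation.Unary.Any as Any using (here; there)
open import Data.List.Relation.Unary.Any.Properties using (lookup-index)
open import Data.List.Relation.Unary.AllPairs using (_∷_)
open import Data.List.Relation.Unary.Unique.Propositional using (Unique)
import Data.List.Relation.Unary.Unique.Propositional.Properties as Unique
open import Data.Nat.Base using (ℕ; zero; suc; _+_; _*_; _∸_; _≤_; _<_; z≤n; s≤s; s≤s⁻¹)
open import Data.Nat.DivMod using (_/_; _%_; m≡m%n+[m/n]*n; m%n<n)
open import Data.Nat.Divisibility using (_∣_; divides; ∣-refl; ∣m+n∣m⇒∣n; >⇒∤)
open import Data.Nat.Properties
  using (_≟_; _<?_; *-assoc; *-cancelˡ-<; *-cancelˡ-≤; *-comm; *-monoʳ-≤; *-monoˡ-≤; *-suc; *-zeroʳ;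
         +-cancelʳ-≤; +-cancelˡ-<; +-cancelˡ-≡; +-comm; +-identityʳ; +-mono-≤; +-monoʳ-<; +-monoʳ-≤;
         +-monoˡ-≤; +-suc; <-cmp; <-irrefl; <-trans; <-≤-trans; <⇒≤; m+[n∸m]≡n; m+n≤o⇒m≤o∸n; m+n≮m;
         m<n⇒m<1+n; m∸n≢0⇒n<m; m∸n≤m; m≤m+n; m≤n+m; m≤n⇒m<n∨m≡n; m≤o∸n⇒m+n≤o; n<1+n; n≤1+n;
         ∸-cancelˡ-≡; ≤-antisym; ≤-refl; ≤-reflexive; ≤-trans; ≤⇒≯; ≤∧≢⇒<; ≮⇒≥;
         +-commutativeSemigroup; module ≤-Reasoning)
open import Algebra.Properties.CommutativeSemigroup +-commutativeSemigroup using (xy∙z≈xz∙y)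
open import Data.Nat.Solver using (module +-*-Solver)
open import Data.Product.Base using (∃; _×_; _,_; proj₁; proj₂)
open import Data.Sum.Base using (_⊎_; inj₁; inj₂)
open import Data.Vec.Base using ([]; _∷_; tabulate; here; there)
open import Data.Vec.Properties using (lookup∘tabulate; lookup⇒[]=; []=⇒lookup)
open import Function.Base using (_∘_)
open import Function.Bundles using (_⇔_; mk⇔)
open import Function.Definitions using (Injective)
open import Level using (Level)
open import Relation.Binary.Definitions using (DecidableEquality; tri<; tri≈; tri>)
open import Relation.Binary.PropositionalEquality
open import Relation.Nullary using (Dec; yes; no; does; contradiction)
open import Relation.Nullary.Decidable using (dec-true; map′)
open import Relation.Unary using (Pred; Decidable)

private variable
  ℓ : Level
  m n : ℕ

dec-true⁻ : {A : Set ℓ} (a? : Dec A) → does a? ≡ true → A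
dec-true⁻ (yes a) _ = a

extend : ∀ {k} {A : Set} → A → (Fin k → A) → ℕ → A
extend {k} d f i with i <? k
... | yes i<k = f (fromℕ< i<k)
... | no  _   = d

extend-< : ∀ {k} {A : Set} {d : A} {f : Fin k → A} {i} (i<k : i < k) → extend d f i ≡ f (fromℕ< i<k)
extend-< {k} {i = i} i<k with i <? k
... | yes _   = refl
... | no  i≮k = contradiction i<k i≮k

extend-injective : ∀ {k} {A : Set} {d : A} {f : Fin k → A} → Injective _≡_ _≡_ f →
                   ∀ {i j} → i < k → j < k → extend d f i ≡ extend d f j → i ≡ j
extend-injective f-injective i<k j<k eq =
  fromℕ<-injective _ _ i<k j<k (f-injective (trans (sym (extend-< i<k)) (trans eq (extend-< j<k))))

m≤n<m+o⇒n∸m<o : ∀ {m n o} → m ≤ n → n < m + o → n ∸ m < o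
m≤n<m+o⇒n∸m<o {m} {n} {o} m≤n n<m+o = +-cancelˡ-< m _ _ (subst (_< m + o) (sym (m+[n∸m]≡n m≤n)) n<m+o)

∃-offset : ∀ {t p w} → t ≤ p → p < t + w → ∃ λ (j : Fin w) → t + toℕ j ≡ p
∃-offset {t} t≤p p<t+w =
  fromℕ< (m≤n<m+o⇒n∸m<o t≤p p<t+w) , trans (cong (t +_) (toℕ-fromℕ< _)) (m+[n∸m]≡n t≤p)

-- Counting subsets of Fin n

x∈tabulate⁺ : {f : Fin n → Bool} {v : Fin n} → f v ≡ true → v ∈ tabulate f
x∈tabulate⁺ {f = f} {v} fv = lookup⇒[]= v (tabulate f) (trans (lookup∘tabulate f v) fv)

x∈tabulate⁻ : {f : Fin n → Bool} {v : Fin n} → v ∈ tabulate f → f v ≡ true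
x∈tabulate⁻ {f = f} {v} v∈ = trans (sym (lookup∘tabulate f v)) ([]=⇒lookup v∈)

decSubset : {P : Pred (Fin n) ℓ} → Decidable P → Subset n
decSubset P? = tabulate (does ∘ P?)

module _ {P : Pred (Fin n) ℓ} (P? : Decidable P) where

  x∈decSubset⁺ : ∀ {v} → P v → v ∈ decSubset P?
  x∈decSubset⁺ {v} pv = x∈tabulate⁺ (dec-true (P? v) pv)

  x∈decSubset⁻ : ∀ {v} → v ∈ decSubset P? → P v
  x∈decSubset⁻ {v} v∈ = dec-true⁻ (P? v) (x∈tabulate⁻ v∈)

x∈membersAt⁻ : (𝓗 : Family n m) {v : Fin n} {i : Fin m} → i ∈ membersAt 𝓗 v → v ∈ 𝓗 i
x∈membersAt⁻ 𝓗 {v} {i} i∈ = lookup⇒[]= v (𝓗 i) (x∈tabulate⁻ i∈)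

x∈p─q⁻ : (p q : Subset n) {x : Fin n} → x ∈ p ─ q → x ∈ p × x ∉ q
x∈p─q⁻ (inside  ∷ p) (outside ∷ q) here       = here , λ ()
x∈p─q⁻ (outside ∷ p) (inside  ∷ q) {zero} ()
x∈p─q⁻ (outside ∷ p) (outside ∷ q) {zero} ()
x∈p─q⁻ (_       ∷ p) (_       ∷ q) (there x∈) =
  let x∈p , x∉q = x∈p─q⁻ p q x∈ in there x∈p , x∉q ∘ drop-there

enum : (p : Subset n) → Fin ∣ p ∣ → Fin n
enum (inside  ∷ p) zero    = zero
enum (inside  ∷ p) (suc i) = suc (enum p i)
enum (outside ∷ p) i       = suc (enum p i)

enum-∈ : (p : Subset n) (i : Fin ∣ p ∣) → enum p i ∈ p
enum-∈ (inside  ∷ p) zero    = here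
enum-∈ (inside  ∷ p) (suc i) = there (enum-∈ p i)
enum-∈ (outside ∷ p) i       = there (enum-∈ p i)

enum-injective : (p : Subset n) → Injective _≡_ _≡_ (enum p)
enum-injective (inside  ∷ p) {zero}  {zero}  _  = refl
enum-injective (inside  ∷ p) {suc i} {suc j} eq = cong suc (enum-injective p (suc-injective eq))
enum-injective (outside ∷ p)                 eq = enum-injective p (suc-injective eq)

enum-surjective : (p : Subset n) {v : Fin n} → v ∈ p → ∃ λ i → enum p i ≡ v
enum-surjective (inside  ∷ p) here       = zero , refl
enum-surjective (inside  ∷ p) (there v∈) = let i , eq = enum-surjective p v∈ in suc i , cong suc eq
enum-surjective (outside ∷ p) (there v∈) = let i , eq = enum-surjective p v∈ in i , cong suc eq

∣p∣≤-code : (p : Subset n) (code : ∀ {v} → v ∈ p → ℕ) →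
            (∀ {v} (v∈p : v ∈ p) → code v∈p < m) →
            (∀ {u v} (u∈p : u ∈ p) (v∈p : v ∈ p) → code u∈p ≡ code v∈p → u ≡ v) →
            ∣ p ∣ ≤ m
∣p∣≤-code p code code<m code-injective = injective⇒≤ {f = codeᶠ} codeᶠ-injective
  where
  codeᶠ : Fin ∣ p ∣ → Fin _
  codeᶠ i = fromℕ< (code<m (enum-∈ p i))
  codeᶠ-injective : Injective _≡_ _≡_ codeᶠ
  codeᶠ-injective eq = enum-injective p (code-injective _ _ (fromℕ<-injective _ _ _ _ eq))

≤∣p∣-injection : (p : Subset n) (g : Fin m → Fin n) → Injective _≡_ _≡_ g → (∀ j → g j ∈ p) → m ≤ ∣ p ∣
≤∣p∣-injection p g g-injective g∈p = injective⇒≤ {f = index} index-injective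
  where
  index : Fin _ → Fin ∣ p ∣
  index j = proj₁ (enum-surjective p (g∈p j))
  enum-index : ∀ j → enum p (index j) ≡ g j
  enum-index j = proj₂ (enum-surjective p (g∈p j))
  index-injective : Injective _≡_ _≡_ index
  index-injective {i} {j} eq =
    g-injective (trans (sym (enum-index i)) (trans (cong (enum p) eq) (enum-index j)))

lookup-injective : {A : Set ℓ} {xs : List A} → Unique xs → Injective _≡_ _≡_ (lookup xs)
lookup-injective (_  ∷ _) {zero}  {zero}  _  = refl
lookup-injective (x∉ ∷ _) {zero}  {suc j} eq = ⊥-elim (All.lookup x∉ (∈-lookup j) eq)
lookup-injective (x∉ ∷ _) {suc i} {zero}  eq = ⊥-elim (All.lookup x∉ (∈-lookup i) (sym eq))
lookup-injective (_  ∷ u) {suc i} {suc j} eq = cong suc (lookup-injective u eq)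

∣p∣≡length : (p : Subset n) {xs : List (Fin n)} → Unique xs →
             (∀ {v} → v ∈ p → v ∈ₗ xs) → (∀ {v} → v ∈ₗ xs → v ∈ p) → ∣ p ∣ ≡ length xs
∣p∣≡length p {xs} unique p⊆xs xs⊆p = ≤-antisym
  (∣p∣≤-code p (λ v∈p → toℕ (Any.index (p⊆xs v∈p))) (λ _ → toℕ<n _) index-injective)
  (≤∣p∣-injection p (lookup xs) (lookup-injective unique) (λ j → xs⊆p (∈-lookup j)))
  where
  index-injective : ∀ {u v} (u∈p : u ∈ p) (v∈p : v ∈ p) →
                    toℕ (Any.index (p⊆xs u∈p)) ≡ toℕ (Any.index (p⊆xs v∈p)) → u ≡ v
  index-injective u∈p v∈p eq = trans (lookup-index (p⊆xs u∈p))
    (trans (cong (lookup xs) (toℕ-injective eq)) (sym (lookup-index (p⊆xs v∈p))))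

module _ {n : ℕ} where
  open DecMembership (_≟ᶠ_ {n}) using (_∈?_)

  fromList : List (Fin n) → Subset n
  fromList xs = decSubset (_∈? xs)

  x∈fromList⁺ : ∀ {v xs} → v ∈ₗ xs → v ∈ fromList xs
  x∈fromList⁺ {xs = xs} = x∈decSubset⁺ (_∈? xs)

  x∈fromList⁻ : ∀ {v xs} → v ∈ fromList xs → v ∈ₗ xs
  x∈fromList⁻ {xs = xs} = x∈decSubset⁻ (_∈? xs)

  ∣fromList∣≡length : {xs : List (Fin n)} → Unique xs → ∣ fromList xs ∣ ≡ length xs
  ∣fromList∣≡length {xs} unique = ∣p∣≡length (fromList xs) unique x∈fromList⁻ x∈fromList⁺

∣p∣≤∣p─q∣+∣q∣ : (p q : Subset n) → ∣ p ∣ ≤ ∣ p ─ q ∣ + ∣ q ∣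
∣p∣≤∣p─q∣+∣q∣ []            []            = ≤-refl
∣p∣≤∣p─q∣+∣q∣ (inside  ∷ p) (inside  ∷ q) = ≤-trans (s≤s (∣p∣≤∣p─q∣+∣q∣ p q)) (≤-reflexive (sym (+-suc _ _)))
∣p∣≤∣p─q∣+∣q∣ (outside ∷ p) (inside  ∷ q) = ≤-trans (∣p∣≤∣p─q∣+∣q∣ p q) (+-monoʳ-≤ ∣ p ─ q ∣ (n≤1+n ∣ q ∣))
∣p∣≤∣p─q∣+∣q∣ (inside  ∷ p) (outside ∷ q) = s≤s (∣p∣≤∣p─q∣+∣q∣ p q)
∣p∣≤∣p─q∣+∣q∣ (outside ∷ p) (outside ∷ q) = ∣p∣≤∣p─q∣+∣q∣ p q

-- The window design

module WindowDesign (h : ℕ) where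

  q : ℕ
  q = suc h

  q*[1+i] : ∀ i → q * suc i ≡ q * i + q
  q*[1+i] i = trans (*-suc q i) (+-comm q (q * i))

  multiple-in-window : ∀ {t i j} → t ≤ q * i → q * j < t + q → j ≤ i
  multiple-in-window {t} {i} {j} t≤qi qj<t+q = s≤s⁻¹ (*-cancelˡ-< q j (suc i) (begin-strict
    q * j     <⟨ qj<t+q ⟩
    t + q     ≤⟨ +-monoˡ-≤ q t≤qi ⟩
    q * i + q ≡⟨ q*[1+i] i ⟨
    q * suc i ∎))
    where open ≤-Reasoning

  -- edge i stands for the i-th edge of X, slot p for the p-th vertex of the absorber.
  data Address : Set where
    edge slot : ℕ → Address

  edge-injective : ∀ {i j} → edge i ≡ edge j → i ≡ j
  edge-injective refl = refl

  slot-injective : ∀ {p p′} → slot p ≡ slot p′ → p ≡ p′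
  slot-injective refl = refl

  data Block : Set where
    window bridge : ℕ → Block

  _≟ᴮ_ : DecidableEquality Block
  window t ≟ᴮ window u = map′ (cong window) (λ { refl → refl }) (t ≟ u)
  bridge t ≟ᴮ bridge u = map′ (cong bridge) (λ { refl → refl }) (t ≟ u)
  window _ ≟ᴮ bridge _ = no λ ()
  bridge _ ≟ᴮ window _ = no λ ()

  start : Block → ℕ
  start (window t) = t
  start (bridge t) = t

  infix 4 _∋_

  _∋_ : Block → Address → Set
  window t ∋ slot p = t ≤ p × p < t + q
  window t ∋ edge i = ⊥
  bridge t ∋ slot p = t ≤ p × p < t + h
  bridge t ∋ edge i = t ≤ q * i × q * i < t + q

  ∋-edge-unique : ∀ {B i j} → B ∋ edge i → B ∋ edge j → i ≡ j
  ∋-edge-unique {bridge t} (t≤qi , qi<t+q) (t≤qj , qj<t+q) =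
    ≤-antisym (multiple-in-window t≤qj qi<t+q) (multiple-in-window t≤qi qj<t+q)

  bridgeEdge : ℕ → ℕ
  bridgeEdge t = (t + h) / q

  bridge∋bridgeEdge : ∀ t → bridge t ∋ edge (bridgeEdge t)
  bridge∋bridgeEdge t = +-cancelʳ-≤ h t (q * e) t+h≤qe+h , (begin-strict
    q * e               ≤⟨ m≤n+m (q * e) ((t + h) % q) ⟩
    (t + h) % q + q * e ≡⟨ t+h≡ ⟨
    t + h               <⟨ +-monoʳ-< t (n<1+n h) ⟩
    t + q               ∎)
    where
    open ≤-Reasoning
    e = bridgeEdge t
    t+h≡ : t + h ≡ (t + h) % q + q * e
    t+h≡ = trans (m≡m%n+[m/n]*n (t + h) q) (cong ((t + h) % q +_) (*-comm e q))
    t+h≤qe+h : t + h ≤ q * e + h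
    t+h≤qe+h = begin
      t + h               ≡⟨ t+h≡ ⟩
      (t + h) % q + q * e ≡⟨ +-comm ((t + h) % q) (q * e) ⟩
      q * e + (t + h) % q ≤⟨ +-monoʳ-≤ (q * e) (s≤s⁻¹ (m%n<n (t + h) q)) ⟩
      q * e + h           ∎

  address : (B : Block) → Fin q → Address
  address (window t) j       = slot (t + toℕ j)
  address (bridge t) zero    = edge (bridgeEdge t)
  address (bridge t) (suc j) = slot (t + toℕ j)

  ∋-address : ∀ B j → B ∋ address B j
  ∋-address (window t) j       = m≤m+n t (toℕ j) , +-monoʳ-< t (toℕ<n j)
  ∋-address (bridge t) zero    = bridge∋bridgeEdge t
  ∋-address (bridge t) (suc j) = m≤m+n t (toℕ j) , +-monoʳ-< t (toℕ<n j)

  address-injective : ∀ B → Injective _≡_ _≡_ (address B)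
  address-injective (window t) eq = toℕ-injective (+-cancelˡ-≡ t _ _ (slot-injective eq))
  address-injective (bridge t) {zero}  {zero}  _  = refl
  address-injective (bridge t) {suc i} {suc j} eq =
    cong suc (toℕ-injective (+-cancelˡ-≡ t _ _ (slot-injective eq)))

  address-surjective : ∀ B {a} → B ∋ a → ∃ λ j → address B j ≡ a
  address-surjective (window t) {slot p} (t≤p , p<t+q) = let j , eq = ∃-offset t≤p p<t+q in j     , cong slot eq
  address-surjective (bridge t) {slot p} (t≤p , p<t+h) = let j , eq = ∃-offset t≤p p<t+h in suc j , cong slot eq
  address-surjective (bridge t) {edge i} t∋i =
    zero , cong edge (∋-edge-unique {bridge t} (bridge∋bridgeEdge t) t∋i)

  offset : Address → Block → ℕ
  offset (slot p) (window t) = p ∸ t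
  offset (slot p) (bridge t) = q + (p ∸ t)
  offset (edge i) B          = q * i ∸ start B

  offset-< : ∀ B {a} → B ∋ a → offset a B < 2 * q
  offset-< (window t) {slot p} (t≤p , p<t+q)   = ≤-trans (m≤n<m+o⇒n∸m<o t≤p p<t+q) (m≤m+n q (q + 0))
  offset-< (bridge t) {slot p} (t≤p , p<t+h)   =
    +-monoʳ-< q (≤-trans (m≤n<m+o⇒n∸m<o t≤p p<t+h) (≤-trans (n≤1+n h) (m≤m+n q 0)))
  offset-< (bridge t) {edge i} (t≤qi , qi<t+q) = ≤-trans (m≤n<m+o⇒n∸m<o t≤qi qi<t+q) (m≤m+n q (q + 0))

  offset-injective : ∀ {B B′ a} → B ∋ a → B′ ∋ a → offset a B ≡ offset a B′ → B ≡ B′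
  offset-injective {window t} {window t′} {slot p} (t≤p , _) (t′≤p , _) eq =
    cong window (∸-cancelˡ-≡ t≤p t′≤p eq)
  offset-injective {bridge t} {bridge t′} {slot p} (t≤p , _) (t′≤p , _) eq =
    cong bridge (∸-cancelˡ-≡ t≤p t′≤p (+-cancelˡ-≡ q _ _ eq))
  offset-injective {bridge t} {bridge t′} {edge i} (t≤qi , _) (t′≤qi , _) eq =
    cong bridge (∸-cancelˡ-≡ t≤qi t′≤qi eq)
  offset-injective {window t} {bridge t′} {slot p} (t≤p , p<t+q) _ eq =
    contradiction (subst (_< q) eq (m≤n<m+o⇒n∸m<o t≤p p<t+q)) (m+n≮m q (p ∸ t′))
  offset-injective {bridge t} {window t′} {slot p} _ (t′≤p , p<t′+q) eq =
    contradiction (subst (_< q) (sym eq) (m≤n<m+o⇒n∸m<o t′≤p p<t′+q)) (m+n≮m q (p ∸ t))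

  ValidAddress : ℕ → Address → Set
  ValidAddress k (edge i) = i < k
  ValidAddress k (slot p) = p < q * k

  ValidBlock : ℕ → Block → Set
  ValidBlock k B = start B + q ≤ q * k

  ∋-valid : ∀ {k} B {a} → ValidBlock k B → B ∋ a → ValidAddress k a
  ∋-valid (window t) {slot p} t+q≤qk (_ , p<t+q)  = <-≤-trans p<t+q t+q≤qk
  ∋-valid (bridge t) {slot p} t+q≤qk (_ , p<t+h)  = <-≤-trans (<-trans p<t+h (+-monoʳ-< t (n<1+n h))) t+q≤qk
  ∋-valid (bridge t) {edge i} t+q≤qk (_ , qi<t+q) = *-cancelˡ-< q i _ (<-≤-trans qi<t+q t+q≤qk)

  data Move : Set where
    skip carry wrap : Move

  blocksOf : Move → ℕ → ℕ → List Block
  blocksOf skip  i s = window s ∷ []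
  blocksOf carry i s = bridge s ∷ []
  blocksOf wrap  i s = bridge s ∷ window (q * i) ∷ []

  positionAfter : Move → ℕ → ℕ → ℕ
  positionAfter skip  i s = s + q
  positionAfter carry i s = s + h
  positionAfter wrap  i s = q * i + q

  marks : Move → Bool
  marks skip  = false
  marks carry = true
  marks wrap  = true

  Aligned : ℕ → ℕ → Set
  Aligned i s = bridge s ∋ edge i

  Legal : Move → ℕ → ℕ → Set
  Legal skip  i s = Aligned i s
  Legal carry i s = Aligned i s
  Legal wrap  i s = s + h ≡ q * i

  legal⇒aligned : ∀ m {i s} → Legal m i s → Aligned i s
  legal⇒aligned skip  aligned = aligned
  legal⇒aligned carry aligned = aligned
  legal⇒aligned wrap  {i} {s} s+h≡qi =
    subst (s ≤_) s+h≡qi (m≤m+n s h) , subst (_< s + q) s+h≡qi (+-monoʳ-< s (n<1+n h))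

  data Covers (m : Move) (i s : ℕ) : Address → Set where
    slot∈ : ∀ {p} → s ≤ p → p < positionAfter m i s → Covers m i s (slot p)
    edge∈ : marks m ≡ true → Covers m i s (edge i)

  blocks-sound : ∀ m {i s B a} → Legal m i s → B ∈ₗ blocksOf m i s → B ∋ a → Covers m i s a
  blocks-sound skip  {a = slot p} _ (here refl) (s≤p , p<s+q) = slot∈ s≤p p<s+q
  blocks-sound carry {a = slot p} _ (here refl) (s≤p , p<s+h) = slot∈ s≤p p<s+h
  blocks-sound carry {a = edge j} aligned (here refl) s∋j
    rewrite ∋-edge-unique {bridge _} s∋j aligned = edge∈ refl
  blocks-sound wrap  {a = slot p} s+h≡qi (here refl) (s≤p , p<s+h) =
    slot∈ s≤p (<-≤-trans (subst (p <_) s+h≡qi p<s+h) (m≤m+n _ q))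
  blocks-sound wrap  {a = edge j} s+h≡qi (here refl) s∋j
    rewrite ∋-edge-unique {bridge _} s∋j (legal⇒aligned wrap s+h≡qi) = edge∈ refl
  blocks-sound wrap  {a = slot p} s+h≡qi (there (here refl)) (qi≤p , p<qi+q) =
    slot∈ (≤-trans (proj₁ (legal⇒aligned wrap s+h≡qi)) qi≤p) p<qi+q
  blocks-sound wrap  {a = edge j} _ (there (here refl)) ()

  blocks-complete : ∀ m {i s a} → Legal m i s → Covers m i s a → ∃ λ B → B ∈ₗ blocksOf m i s × B ∋ a
  blocks-complete skip  _       (slot∈ s≤p p<s+q) = window _ , here refl , s≤p , p<s+q
  blocks-complete carry _       (slot∈ s≤p p<s+h) = bridge _ , here refl , s≤p , p<s+h
  blocks-complete carry aligned (edge∈ _)         = bridge _ , here refl , aligned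
  blocks-complete wrap  s+h≡qi  (edge∈ _)         = bridge _ , here refl , legal⇒aligned wrap s+h≡qi
  blocks-complete wrap  {i} s+h≡qi (slot∈ {p} s≤p p<qi+q) with p <? q * i
  ... | yes p<qi = bridge _ , here refl , s≤p , subst (p <_) (sym s+h≡qi) p<qi
  ... | no  p≮qi = window (q * i) , there (here refl) , ≮⇒≥ p≮qi , p<qi+q

  blocks-disjoint : ∀ m {i s B B′ a} → Legal m i s → B ∈ₗ blocksOf m i s → B′ ∈ₗ blocksOf m i s →
                    B ∋ a → B′ ∋ a → B ≡ B′
  blocks-disjoint skip  _ (here refl)         (here refl)         _ _ = refl
  blocks-disjoint carry _ (here refl)         (here refl)         _ _ = refl
  blocks-disjoint wrap  _ (here refl)         (here refl)         _ _ = refl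
  blocks-disjoint wrap  _ (there (here refl)) (there (here refl)) _ _ = refl
  blocks-disjoint wrap {a = slot p} s+h≡qi (here refl) (there (here refl)) (_ , p<s+h) (qi≤p , _) =
    contradiction (subst (p <_) s+h≡qi p<s+h) (≤⇒≯ qi≤p)
  blocks-disjoint wrap {a = slot p} s+h≡qi (there (here refl)) (here refl) (qi≤p , _) (_ , p<s+h) =
    contradiction (subst (p <_) s+h≡qi p<s+h) (≤⇒≯ qi≤p)
  blocks-disjoint wrap {a = edge j} _ (here refl) (there (here refl)) _ ()
  blocks-disjoint wrap {a = edge j} _ (there (here refl)) (here refl) ()

  aligned⇒valid : ∀ {i s} → Aligned i s → ValidBlock (suc i) (bridge s)
  aligned⇒valid {i} (s≤qi , _) = ≤-trans (+-monoˡ-≤ q s≤qi) (≤-reflexive (sym (q*[1+i] i)))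

  blocks-valid : ∀ m {i s B} → Legal m i s → B ∈ₗ blocksOf m i s → ValidBlock (suc i) B
  blocks-valid skip  aligned     (here refl)         = aligned⇒valid aligned
  blocks-valid carry aligned     (here refl)         = aligned⇒valid aligned
  blocks-valid wrap  s+h≡qi      (here refl)         = aligned⇒valid (legal⇒aligned wrap s+h≡qi)
  blocks-valid wrap  {i} _       (there (here refl)) = ≤-reflexive (sym (q*[1+i] i))

  positionAfter-≥ : ∀ m {i s} → Legal m i s → s ≤ positionAfter m i s
  positionAfter-≥ skip  {s = s} _  = m≤m+n s q
  positionAfter-≥ carry {s = s} _  = m≤m+n s h
  positionAfter-≥ wrap  {i} s+h≡qi = ≤-trans (proj₁ (legal⇒aligned wrap s+h≡qi)) (m≤m+n (q * i) q)

  moveFor : Bool → ℕ → Move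
  moveFor false r = skip
  moveFor true  r with r ≟ h
  ... | yes _ = wrap
  ... | no  _ = carry

  residueAfter : Move → ℕ → ℕ
  residueAfter skip  r = r
  residueAfter carry r = suc r
  residueAfter wrap  r = 0

  marks-moveFor : ∀ b r → marks (moveFor b r) ≡ b
  marks-moveFor false r = refl
  marks-moveFor true  r with r ≟ h
  ... | yes _ = refl
  ... | no  _ = refl

  residueAfter-≤ : ∀ b {r} → r ≤ h → residueAfter (moveFor b r) r ≤ h
  residueAfter-≤ false r≤h = r≤h
  residueAfter-≤ true  {r} r≤h with r ≟ h
  ... | yes _   = z≤n
  ... | no  r≢h = ≤∧≢⇒< r≤h r≢h

  moveFor-legal : ∀ b {i s r} → s + r ≡ q * i → r ≤ h → Legal (moveFor b r) i s
  moveFor-legal false {s = s} {r} s+r≡qi r≤h =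
    subst (s ≤_) s+r≡qi (m≤m+n s r) , subst (_< s + q) s+r≡qi (+-monoʳ-< s (s≤s r≤h))
  moveFor-legal true {r = r} s+r≡qi r≤h with r ≟ h
  ... | yes refl = s+r≡qi
  ... | no  _    = moveFor-legal false s+r≡qi r≤h

  positionAfter+residueAfter : ∀ m {i s r} → s + r ≡ q * i →
                               positionAfter m i s + residueAfter m r ≡ q * suc i
  positionAfter+residueAfter skip {i} {s} {r} s+r≡qi = begin
    s + q + r ≡⟨ xy∙z≈xz∙y s q r ⟩
    s + r + q ≡⟨ cong (_+ q) s+r≡qi ⟩
    q * i + q ≡⟨ q*[1+i] i ⟨
    q * suc i ∎
    where open ≡-Reasoning
  positionAfter+residueAfter carry {i} {s} {r} s+r≡qi = begin
    s + h + suc r   ≡⟨ +-suc (s + h) r ⟩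
    suc (s + h + r) ≡⟨ cong suc (xy∙z≈xz∙y s h r) ⟩
    suc (s + r + h) ≡⟨ +-suc (s + r) h ⟨
    s + r + q       ≡⟨ cong (_+ q) s+r≡qi ⟩
    q * i + q       ≡⟨ q*[1+i] i ⟨
    q * suc i       ∎
    where open ≡-Reasoning
  positionAfter+residueAfter wrap {i} _ = trans (+-identityʳ (q * i + q)) (sym (q*[1+i] i))

  Congruent : ℕ → ℕ → Set
  Congruent c r = ∃ λ d → c ≡ r + q * d

  residueAfter-congruent : ∀ b {c r} → Congruent c r →
                           Congruent (if b then suc c else c) (residueAfter (moveFor b r) r)
  residueAfter-congruent false c≡r+qd = c≡r+qd
  residueAfter-congruent true {r = r} (d , c≡r+qd) with r ≟ h
  ... | yes refl = suc d , trans (cong suc c≡r+qd) (sym (*-suc q d))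
  ... | no  _    = d , cong suc c≡r+qd

  congruent-residue≡0 : ∀ {c r} → r ≤ h → Congruent c r → q ∣ c → r ≡ 0
  congruent-residue≡0 {r = zero}  _     _              _   = refl
  congruent-residue≡0 {r = suc r} 1+r≤h (d , c≡1+r+qd) q∣c =
    contradiction (∣m+n∣m⇒∣n q∣qd+1+r (divides d (*-comm q d))) (>⇒∤ (s≤s 1+r≤h))
    where
    q∣qd+1+r : q ∣ q * d + suc r
    q∣qd+1+r = subst (q ∣_) (trans c≡1+r+qd (+-comm (suc r) (q * d))) q∣c

  module Scan (ℓ : ℕ → Bool) where

    residue : ℕ → ℕ
    residue zero    = 0
    residue (suc i) = residueAfter (moveFor (ℓ i) (residue i)) (residue i)

    move : ℕ → Move
    move i = moveFor (ℓ i) (residue i)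

    position : ℕ → ℕ
    position zero    = 0
    position (suc i) = positionAfter (move i) i (position i)

    count : ℕ → ℕ
    count zero    = 0
    count (suc i) = if ℓ i then suc (count i) else count i

    residue-≤ : ∀ i → residue i ≤ h
    residue-≤ zero    = z≤n
    residue-≤ (suc i) = residueAfter-≤ (ℓ i) (residue-≤ i)

    position+residue : ∀ i → position i + residue i ≡ q * i
    position+residue zero    = sym (*-zeroʳ q)
    position+residue (suc i) = positionAfter+residueAfter (move i) (position+residue i)

    legal : ∀ i → Legal (move i) i (position i)
    legal i = moveFor-legal (ℓ i) (position+residue i) (residue-≤ i)

    count-congruent : ∀ i → Congruent (count i) (residue i)
    count-congruent zero    = 0 , sym (*-zeroʳ q)
    count-congruent (suc i) = residueAfter-congruent (ℓ i) (count-congruent i)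

    position≤ : ∀ k → position k ≤ q * k
    position≤ k = subst (position k ≤_) (position+residue k) (m≤m+n (position k) (residue k))

    position≡ : ∀ {k} → q ∣ count k → position k ≡ q * k
    position≡ {k} q∣count = begin
      position k             ≡⟨ +-identityʳ (position k) ⟨
      position k + 0         ≡⟨ cong (position k +_) residueₖ≡0 ⟨
      position k + residue k ≡⟨ position+residue k ⟩
      q * k                  ∎
      where
      open ≡-Reasoning
      residueₖ≡0 = congruent-residue≡0 (residue-≤ k) (count-congruent k) q∣count

    position-mono : ∀ {i j} → i ≤ j → position i ≤ position j
    position-mono {j = zero}  z≤n   = ≤-refl
    position-mono {i} {suc j} i≤1+j with m≤n⇒m<n∨m≡n i≤1+j
    ... | inj₂ refl  = ≤-refl
    ... | inj₁ i<1+j = ≤-trans (position-mono (s≤s⁻¹ i<1+j)) (positionAfter-≥ (move j) (legal j))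

    Region : ℕ → Address → Set
    Region i = Covers (move i) i (position i)

    region-unique : ∀ {i j a} → Region i a → Region j a → i ≡ j
    region-unique (edge∈ _) (edge∈ _) = refl
    region-unique {i} {j} (slot∈ pᵢ≤p p<pᵢ₊₁) (slot∈ pⱼ≤p p<pⱼ₊₁) with <-cmp i j
    ... | tri≈ _ i≡j _ = i≡j
    ... | tri< i<j _ _ = contradiction (<-≤-trans p<pᵢ₊₁ (≤-trans (position-mono i<j) pⱼ≤p)) (<-irrefl refl)
    ... | tri> _ _ j<i = contradiction (<-≤-trans p<pⱼ₊₁ (≤-trans (position-mono j<i) pᵢ≤p)) (<-irrefl refl)

    slot-region : ∀ {k p} → p < position k → ∃ λ i → i < k × Region i (slot p)
    slot-region {suc k} {p} p<pₖ₊₁ with p <? position k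
    ... | yes p<pₖ = let i , i<k , region = slot-region p<pₖ in i , m<n⇒m<1+n i<k , region
    ... | no  p≮pₖ = k , ≤-refl , slot∈ (≮⇒≥ p≮pₖ) p<pₖ₊₁

    step : ℕ → List Block
    step i = blocksOf (move i) i (position i)

    selection : ℕ → List Block
    selection zero    = []
    selection (suc k) = step k ++ selection k

    ∈-selection⁻ : ∀ {k B} → B ∈ₗ selection k → ∃ λ i → i < k × B ∈ₗ step i
    ∈-selection⁻ {suc k} B∈ with ∈-++⁻ (step k) B∈
    ... | inj₁ B∈stepₖ = k , ≤-refl , B∈stepₖ
    ... | inj₂ B∈selₖ  = let i , i<k , B∈stepᵢ = ∈-selection⁻ B∈selₖ in i , m<n⇒m<1+n i<k , B∈stepᵢ

    ∈-selection⁺ : ∀ {k i B} → i < k → B ∈ₗ step i → B ∈ₗ selection k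
    ∈-selection⁺ {suc k} i<1+k B∈stepᵢ with m≤n⇒m<n∨m≡n (s≤s⁻¹ i<1+k)
    ... | inj₁ i<k  = ∈-++⁺ʳ (step k) (∈-selection⁺ i<k B∈stepᵢ)
    ... | inj₂ refl = ∈-++⁺ˡ B∈stepᵢ

    data Active (k : ℕ) : Address → Set where
      edge∈ : ∀ {i} → i < k → ℓ i ≡ true → Active k (edge i)
      slot∈ : ∀ {p} → p < q * k → Active k (slot p)

    active-region : ∀ {k a} → q ∣ count k → Active k a → ∃ λ i → i < k × Region i a
    active-region _       (edge∈ {i} i<k ℓᵢ) = i , i<k , edge∈ (trans (marks-moveFor (ℓ i) (residue i)) ℓᵢ)
    active-region q∣count (slot∈ p<qk)       = slot-region (subst (_ <_) (sym (position≡ q∣count)) p<qk)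

    selection-valid : ∀ {k B} → B ∈ₗ selection k → ValidBlock k B
    selection-valid {k} B∈ with ∈-selection⁻ {k} B∈
    ... | i , i<k , B∈stepᵢ = ≤-trans (blocks-valid (move i) (legal i) B∈stepᵢ) (*-monoʳ-≤ q i<k)

    selection-sound : ∀ {k B a} → B ∈ₗ selection k → B ∋ a → Active k a
    selection-sound {k} B∈ B∋a with ∈-selection⁻ {k} B∈
    ... | i , i<k , B∈stepᵢ with blocks-sound (move i) (legal i) B∈stepᵢ B∋a
    ...   | slot∈ _ p<pᵢ₊₁ = slot∈ (<-≤-trans p<pᵢ₊₁ (≤-trans (position-mono i<k) (position≤ k)))
    ...   | edge∈ marked   = edge∈ i<k (trans (sym (marks-moveFor (ℓ i) (residue i))) marked)

    selection-complete : ∀ {k a} → q ∣ count k → Active k a → ∃ λ B → B ∈ₗ selection k × B ∋ a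
    selection-complete {k} q∣count active with active-region q∣count active
    ... | i , i<k , regionᵢ with blocks-complete (move i) (legal i) regionᵢ
    ...   | B , B∈stepᵢ , B∋a = B , ∈-selection⁺ {k} i<k B∈stepᵢ , B∋a

    selection-disjoint : ∀ {k B B′ a} → B ∈ₗ selection k → B′ ∈ₗ selection k → B ∋ a → B′ ∋ a → B ≡ B′
    selection-disjoint {k} B∈ B′∈ B∋a B′∋a with ∈-selection⁻ {k} B∈ | ∈-selection⁻ {k} B′∈
    ... | i , _ , B∈stepᵢ | j , _ , B′∈stepⱼ
      with region-unique (blocks-sound (move i) (legal i) B∈stepᵢ B∋a)
                         (blocks-sound (move j) (legal j) B′∈stepⱼ B′∋a)
    ... | refl = blocks-disjoint (move i) (legal i) B∈stepᵢ B′∈stepⱼ B∋a B′∋a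

-- Realising the design inside G

module Realisation (h : ℕ) {n : ℕ} (G X : Subset n) where
  open WindowDesign h

  record Labelling (k : ℕ) : Set where
    field
      vertex           : Address → Fin n
      vertex-injective : ∀ {a b} → ValidAddress k a → ValidAddress k b → vertex a ≡ vertex b → a ≡ b
      edge∈X           : ∀ {i} → i < k → vertex (edge i) ∈ X
      X⊆edges          : ∀ {v} → v ∈ X → ∃ λ i → i < k × vertex (edge i) ≡ v
      slot∈G           : ∀ {p} → p < q * k → vertex (slot p) ∈ G
      slot∉X           : ∀ {p} → p < q * k → vertex (slot p) ∉ X

  module Construction {k : ℕ} (labelling : Labelling k) where
    open Labelling labelling

    A : Subset n
    A = fromList (applyUpTo (vertex ∘ slot) (q * k))

    x∈A⁺ : ∀ {p} → p < q * k → vertex (slot p) ∈ A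
    x∈A⁺ p<qk = x∈fromList⁺ (∈-applyUpTo⁺ (vertex ∘ slot) p<qk)

    x∈A⁻ : ∀ {v} → v ∈ A → ∃ λ p → p < q * k × v ≡ vertex (slot p)
    x∈A⁻ v∈A = ∈-applyUpTo⁻ (vertex ∘ slot) (x∈fromList⁻ v∈A)

    A⊆G : A ⊆ G
    A⊆G v∈A with x∈A⁻ v∈A
    ... | p , p<qk , refl = slot∈G p<qk

    X∩A-empty : EdgeDisjoint X A
    X∩A-empty (v , v∈X∩A) with x∈p∩q⁻ X A v∈X∩A
    ... | v∈X , v∈A with x∈A⁻ v∈A
    ...   | p , p<qk , refl = slot∉X p<qk v∈X

    ∣A∣≡qk : ∣ A ∣ ≡ q * k
    ∣A∣≡qk = trans (∣fromList∣≡length (Unique.applyUpTo⁺₁ (vertex ∘ slot) (q * k) slots-distinct))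
                   (length-applyUpTo (vertex ∘ slot) (q * k))
      where
      slots-distinct : ∀ {p p′} → p < p′ → p′ < q * k → vertex (slot p) ≢ vertex (slot p′)
      slots-distinct p<p′ p′<qk eq =
        <-irrefl (slot-injective (vertex-injective (<-trans p<p′ p′<qk) p′<qk eq)) p<p′

    T : ℕ
    T = q * k ∸ h

    valid⇒<T : ∀ {t} → t + q ≤ q * k → t < T
    valid⇒<T {t} t+q≤qk = m+n≤o⇒m≤o∸n (suc t) (subst (_≤ q * k) (+-suc t h) t+q≤qk)

    <T⇒valid : ∀ {t} → t < T → t + q ≤ q * k
    <T⇒valid {t} t<T = subst (_≤ q * k) (sym (+-suc t h)) (m≤o∸n⇒m+n≤o (suc t) h≤qk t<T)
      where
      h≤qk : h ≤ q * k
      h≤qk = <⇒≤ (m∸n≢0⇒n<m (λ qk∸h≡0 → contradiction (subst (suc t ≤_) qk∸h≡0 t<T) λ ()))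

    blockOf : Fin T ⊎ Fin T → Block
    blockOf (inj₁ t) = window (toℕ t)
    blockOf (inj₂ t) = bridge (toℕ t)

    blockOf-injective : Injective _≡_ _≡_ blockOf
    blockOf-injective {inj₁ t} {inj₁ u} eq = cong inj₁ (toℕ-injective (cong start eq))
    blockOf-injective {inj₂ t} {inj₂ u} eq = cong inj₂ (toℕ-injective (cong start eq))
    blockOf-injective {inj₁ _} {inj₂ _} ()
    blockOf-injective {inj₂ _} {inj₁ _} ()

    blockOf-valid : ∀ c → ValidBlock k (blockOf c)
    blockOf-valid (inj₁ t) = <T⇒valid (toℕ<n t)
    blockOf-valid (inj₂ t) = <T⇒valid (toℕ<n t)

    codeOf : ∀ B → ValidBlock k B → Fin T ⊎ Fin T
    codeOf (window t) valid = inj₁ (fromℕ< (valid⇒<T valid))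
    codeOf (bridge t) valid = inj₂ (fromℕ< (valid⇒<T valid))

    blockOf-codeOf : ∀ B (valid : ValidBlock k B) → blockOf (codeOf B valid) ≡ B
    blockOf-codeOf (window t) valid = cong window (toℕ-fromℕ< (valid⇒<T valid))
    blockOf-codeOf (bridge t) valid = cong bridge (toℕ-fromℕ< (valid⇒<T valid))

    blockAt : Fin (T + T) → Block
    blockAt = blockOf ∘ splitAt T

    blockAt-injective : Injective _≡_ _≡_ blockAt
    blockAt-injective {i} {j} eq =
      trans (sym (join-splitAt T T i)) (trans (cong (join T T) (blockOf-injective eq)) (join-splitAt T T j))

    blockAt-valid : ∀ i → ValidBlock k (blockAt i)
    blockAt-valid i = blockOf-valid (splitAt T i)

    indexOf : ∀ B → ValidBlock k B → Fin (T + T)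
    indexOf B valid = join T T (codeOf B valid)

    blockAt-indexOf : ∀ B (valid : ValidBlock k B) → blockAt (indexOf B valid) ≡ B
    blockAt-indexOf B valid = trans (cong blockOf (splitAt-join T T (codeOf B valid))) (blockOf-codeOf B valid)

    members : Fin (T + T) → Fin q → Fin n
    members i = vertex ∘ address (blockAt i)

    𝓗 : Family n (T + T)
    𝓗 i = fromList (List.tabulate (members i))

    address-valid : ∀ i j → ValidAddress k (address (blockAt i) j)
    address-valid i j = ∋-valid (blockAt i) (blockAt-valid i) (∋-address (blockAt i) j)

    x∈𝓗⁺ : ∀ {i a} → blockAt i ∋ a → vertex a ∈ 𝓗 i
    x∈𝓗⁺ {i} B∋a with address-surjective (blockAt i) B∋a
    ... | j , refl = x∈fromList⁺ (∈-tabulate⁺ {f = members i} j)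

    x∈𝓗⁻ : ∀ {i v} → v ∈ 𝓗 i → ∃ λ a → blockAt i ∋ a × ValidAddress k a × v ≡ vertex a
    x∈𝓗⁻ {i} v∈𝓗 with ∈-tabulate⁻ {f = members i} (x∈fromList⁻ v∈𝓗)
    ... | j , refl = address (blockAt i) j , ∋-address (blockAt i) j , address-valid i j , refl

    vertex∈𝓗⁻ : ∀ {i a} → ValidAddress k a → vertex a ∈ 𝓗 i → blockAt i ∋ a
    vertex∈𝓗⁻ valid v∈𝓗 with x∈𝓗⁻ v∈𝓗
    ... | a′ , B∋a′ , valid′ , eq rewrite vertex-injective valid valid′ eq = B∋a′

    ∣𝓗∣≡q : ∀ i → ∣ 𝓗 i ∣ ≡ q
    ∣𝓗∣≡q i = trans (∣fromList∣≡length (Unique.tabulate⁺ members-injective)) (length-tabulate (members i))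
      where
      members-injective : Injective _≡_ _≡_ (members i)
      members-injective eq =
        address-injective (blockAt i) (vertex-injective (address-valid i _) (address-valid i _) eq)

    ∣𝓗∣≤2q : ∀ i → ∣ 𝓗 i ∣ ≤ 2 * q
    ∣𝓗∣≤2q i = subst (_≤ 2 * q) (sym (∣𝓗∣≡q i)) (m≤m+n q (q + 0))

    𝓗⊆X∪A : ∀ i → 𝓗 i ⊆ X ∪ A
    𝓗⊆X∪A i v∈𝓗 with x∈𝓗⁻ v∈𝓗
    ... | edge j , _ , j<k  , refl = x∈p∪q⁺ (inj₁ (edge∈X j<k))
    ... | slot p , _ , p<qk , refl = x∈p∪q⁺ (inj₂ (x∈A⁺ p<qk))

    ∣𝓗∩X∣≤1 : ∀ i → ∣ 𝓗 i ∩ X ∣ ≤ 1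
    ∣𝓗∩X∣≤1 i = ∣p∣≤-code (𝓗 i ∩ X) (λ _ → 0) (λ _ → s≤s z≤n) the-edge-unique
      where
      the-edge : ∀ {v} → v ∈ 𝓗 i ∩ X → ∃ λ j → blockAt i ∋ edge j × v ≡ vertex (edge j)
      the-edge v∈𝓗∩X with x∈p∩q⁻ (𝓗 i) X v∈𝓗∩X
      ... | v∈𝓗 , v∈X with x∈𝓗⁻ v∈𝓗
      ...   | edge j , B∋j , _    , refl = j , B∋j , refl
      ...   | slot p , _   , p<qk , refl = contradiction v∈X (slot∉X p<qk)
      the-edge-unique : ∀ {u v} → u ∈ 𝓗 i ∩ X → v ∈ 𝓗 i ∩ X → 0 ≡ 0 → u ≡ v
      the-edge-unique u∈ v∈ _ with the-edge u∈ | the-edge v∈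
      ... | j , B∋j , refl | j′ , B∋j′ , refl = cong (vertex ∘ edge) (∋-edge-unique B∋j B∋j′)

    degree≤2q : ∀ {a} → ValidAddress k a → ∣ membersAt 𝓗 (vertex a) ∣ ≤ 2 * q
    degree≤2q {a} valid = ∣p∣≤-code (membersAt 𝓗 (vertex a)) (λ {i} _ → offset a (blockAt i))
      (λ i∈ → offset-< _ (contains i∈))
      (λ i∈ j∈ eq → blockAt-injective (offset-injective (contains i∈) (contains j∈) eq))
      where
      contains : ∀ {i} → i ∈ membersAt 𝓗 (vertex a) → blockAt i ∋ a
      contains i∈ = vertex∈𝓗⁻ valid (x∈membersAt⁻ 𝓗 i∈)

    edgeRefined : EdgeRefined (2 * q) 𝓗 (X ∪ A)
    edgeRefined v v∈X∪A with x∈p∪q⁻ X A v∈X∪A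
    ... | inj₁ v∈X with X⊆edges v∈X
    ...   | i , i<k , refl = degree≤2q i<k
    edgeRefined v v∈X∪A | inj₂ v∈A with x∈A⁻ v∈A
    ...   | p , p<qk , refl = degree≤2q p<qk

    module Decomposition (L : Subset n) (L⊆X : L ⊆ X) (q∣∣L∣ : q ∣ ∣ L ∣) where

      marked : ℕ → Bool
      marked i = does (vertex (edge i) ∈ˢ? L)

      open Scan marked

      markedVertices : ℕ → List (Fin n)
      markedVertices i = filter (_∈ˢ? L) (applyDownFrom (vertex ∘ edge) i)

      length-markedVertices : ∀ i → length (markedVertices i) ≡ count i
      length-markedVertices zero = refl
      length-markedVertices (suc i) with does (vertex (edge i) ∈ˢ? L)
      ... | true  = cong suc (length-markedVertices i)
      ... | false = length-markedVertices i

      ∣L∣≡count : ∣ L ∣ ≡ count k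
      ∣L∣≡count = trans (∣p∣≡length L unique L⊆marked marked⊆L) (length-markedVertices k)
        where
        edges-distinct : ∀ {i j} → j < i → i < k → vertex (edge i) ≢ vertex (edge j)
        edges-distinct j<i i<k eq =
          <-irrefl (sym (edge-injective (vertex-injective i<k (<-trans j<i i<k) eq))) j<i
        unique : Unique (markedVertices k)
        unique = Unique.filter⁺ (_∈ˢ? L) (Unique.applyDownFrom⁺₁ (vertex ∘ edge) k edges-distinct)
        L⊆marked : ∀ {v} → v ∈ L → v ∈ₗ markedVertices k
        L⊆marked v∈L with X⊆edges (L⊆X v∈L)
        ... | i , i<k , refl = ∈-filter⁺ (_∈ˢ? L) (∈-applyDownFrom⁺ (vertex ∘ edge) i<k) v∈L
        marked⊆L : ∀ {v} → v ∈ₗ markedVertices k → v ∈ L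
        marked⊆L v∈ = proj₂ (∈-filter⁻ (_∈ˢ? L) {xs = applyDownFrom (vertex ∘ edge) k} v∈)

      open DecMembership _≟ᴮ_ using () renaming (_∈?_ to _∈ᴮ?_)

      S : Subset (T + T)
      S = decSubset (λ i → blockAt i ∈ᴮ? selection k)

      selected⁺ : ∀ {i} → blockAt i ∈ₗ selection k → i ∈ S
      selected⁺ = x∈decSubset⁺ (λ i → blockAt i ∈ᴮ? selection k)

      selected⁻ : ∀ {i} → i ∈ S → blockAt i ∈ₗ selection k
      selected⁻ = x∈decSubset⁻ (λ i → blockAt i ∈ᴮ? selection k)

      covered : ∀ {a} → Active k a → ∃ λ i → i ∈ S × vertex a ∈ 𝓗 i
      covered active with selection-complete (subst (q ∣_) ∣L∣≡count q∣∣L∣) active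
      ... | B , B∈sel , B∋a = indexOf B valid ,
          selected⁺ (subst (_∈ₗ selection k) (sym B≡) B∈sel) , x∈𝓗⁺ (subst (_∋ _) (sym B≡) B∋a)
        where
        valid = selection-valid B∈sel
        B≡ = blockAt-indexOf B valid

      active⇒∈L∪A : ∀ {a} → Active k a → vertex a ∈ L ∪ A
      active⇒∈L∪A (edge∈ {i} _ markedᵢ) = x∈p∪q⁺ (inj₁ (dec-true⁻ (vertex (edge i) ∈ˢ? L) markedᵢ))
      active⇒∈L∪A (slot∈ p<qk)          = x∈p∪q⁺ (inj₂ (x∈A⁺ p<qk))

      disjoint : ∀ i j → i ∈ S → j ∈ S → i ≢ j → EdgeDisjoint (𝓗 i) (𝓗 j)
      disjoint i j i∈S j∈S i≢j (v , v∈𝓗ᵢ∩𝓗ⱼ) with x∈p∩q⁻ (𝓗 i) (𝓗 j) v∈𝓗ᵢ∩𝓗ⱼ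
      ... | v∈𝓗ᵢ , v∈𝓗ⱼ with x∈𝓗⁻ v∈𝓗ᵢ
      ...   | a , Bᵢ∋a , valid , refl = i≢j (blockAt-injective
              (selection-disjoint {k} (selected⁻ i∈S) (selected⁻ j∈S) Bᵢ∋a (vertex∈𝓗⁻ valid v∈𝓗ⱼ)))

      cover : ∀ v → (v ∈ L ∪ A) ⇔ (∃ λ i → i ∈ S × v ∈ 𝓗 i)
      cover v = mk⇔ to from
        where
        to : v ∈ L ∪ A → ∃ λ i → i ∈ S × v ∈ 𝓗 i
        to v∈L∪A with x∈p∪q⁻ L A v∈L∪A
        ... | inj₁ v∈L with X⊆edges (L⊆X v∈L)
        ...   | i , i<k , refl = covered (edge∈ i<k (dec-true (v ∈ˢ? L) v∈L))
        to v∈L∪A | inj₂ v∈A with x∈A⁻ v∈A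
        ...   | p , p<qk , refl = covered (slot∈ p<qk)
        from : (∃ λ i → i ∈ S × v ∈ 𝓗 i) → v ∈ L ∪ A
        from (i , i∈S , v∈𝓗ᵢ) with x∈𝓗⁻ v∈𝓗ᵢ
        ... | a , B∋a , _ , refl = active⇒∈L∪A (selection-sound (selected⁻ i∈S) B∋a)

      decomposes : DecomposesAs 𝓗 S (L ∪ A)
      decomposes = disjoint , cover

    decomposition : ∀ L → L ⊆ X → q ∣ ∣ L ∣ → ∃ λ S → DecomposesAs 𝓗 S (L ∪ A)
    decomposition L L⊆X q∣∣L∣ = S , decomposes
      where open Decomposition L L⊆X q∣∣L∣

    isRefinedOmniAbsorber : IsRefinedOmniAbsorber (2 * q) q X A 𝓗
    isRefinedOmniAbsorber =
      (X∩A-empty , (λ i → 𝓗⊆X∪A i , ∣𝓗∣≡q i , ∣𝓗∩X∣≤1 i) , decomposition) , edgeRefined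

    isRefinedRefiner : IsRefinedRefiner (2 * q) q X A 𝓗
    isRefinedRefiner =
      (X∩A-empty , (λ i → 𝓗⊆X∪A i , subst (q ∣_) (sym (∣𝓗∣≡q i)) ∣-refl , ∣𝓗∩X∣≤1 i) , decomposition) ,
      edgeRefined , (λ i → ∣𝓗∣≤2q i , ∣𝓗∣≤2q i)

    ∣A∣≤2qk : ∣ A ∣ ≤ 2 * q * k
    ∣A∣≤2qk = subst (_≤ 2 * q * k) (sym ∣A∣≡qk) (*-monoˡ-≤ k (m≤m+n q (q + 0)))

    T+T≤2qk : T + T ≤ 2 * q * k
    T+T≤2qk = begin
      T + T         ≤⟨ +-mono-≤ (m∸n≤m (q * k) h) (m∸n≤m (q * k) h) ⟩
      q * k + q * k ≡⟨ cong (q * k +_) (+-identityʳ (q * k)) ⟨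
      2 * (q * k)   ≡⟨ *-assoc 2 q k ⟨
      2 * q * k     ∎
      where open ≤-Reasoning

module _ (h : ℕ) {n : ℕ} (G X : Subset (suc n)) where
  open WindowDesign h
  open Realisation h G X

  enumerationLabelling : q * ∣ X ∣ ≤ ∣ G ─ X ∣ → Labelling ∣ X ∣
  enumerationLabelling room = record
    { vertex           = vertex
    ; vertex-injective = vertex-injective
    ; edge∈X           = edge∈X
    ; X⊆edges          = X⊆edges
    ; slot∈G           = λ p<qk → proj₁ (slot∈G─X p<qk)
    ; slot∉X           = λ p<qk → proj₂ (slot∈G─X p<qk)
    }
    where
    vertex : Address → Fin (suc n)
    vertex (edge i) = extend zero (enum X) i
    vertex (slot p) = extend zero (enum (G ─ X)) p
    edge∈X : ∀ {i} → i < ∣ X ∣ → vertex (edge i) ∈ X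
    edge∈X i<k = subst (_∈ X) (sym (extend-< i<k)) (enum-∈ X _)
    slot∈G─X : ∀ {p} → p < q * ∣ X ∣ → vertex (slot p) ∈ G × vertex (slot p) ∉ X
    slot∈G─X p<qk = x∈p─q⁻ G X (subst (_∈ G ─ X) (sym (extend-< (<-≤-trans p<qk room))) (enum-∈ (G ─ X) _))
    X⊆edges : ∀ {v} → v ∈ X → ∃ λ i → i < ∣ X ∣ × vertex (edge i) ≡ v
    X⊆edges v∈X with enum-surjective X v∈X
    ... | j , refl = toℕ j , toℕ<n j , trans (extend-< (toℕ<n j)) (cong (enum X) (fromℕ<-toℕ j (toℕ<n j)))
    vertex-injective : ∀ {a b} → ValidAddress ∣ X ∣ a → ValidAddress ∣ X ∣ b → vertex a ≡ vertex b → a ≡ b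
    vertex-injective {edge i} {edge j}  i<k  j<k   eq =
      cong edge (extend-injective (enum-injective X) i<k j<k eq)
    vertex-injective {slot p} {slot p′} p<qk p′<qk eq =
      cong slot (extend-injective (enum-injective (G ─ X)) (<-≤-trans p<qk room) (<-≤-trans p′<qk room) eq)
    vertex-injective {edge i} {slot p}  i<k  p<qk  eq =
      contradiction (subst (_∈ X) eq (edge∈X i<k)) (proj₂ (slot∈G─X p<qk))
    vertex-injective {slot p} {edge i}  p<qk i<k   eq =
      contradiction (subst (_∈ X) (sym eq) (edge∈X i<k)) (proj₂ (slot∈G─X p<qk))

OmniAbsorberIn : ℕ → Hyp1 n → Hyp1 n → Set
OmniAbsorberIn {n} q G X = ∃ λ (A : Hyp1 n) → A ⊆ G × ∃ λ m → ∃ λ (𝓗 : Family n m) →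
  IsRefinedOmniAbsorber (2 * q) q X A 𝓗 × LeTimesMaxDegLog (2 * q) (Δ₁ A) X

RefinerIn : ℕ → Hyp1 n → Hyp1 n → Set
RefinerIn {n} q G X = ∃ λ (R : Hyp1 n) → R ⊆ G × ∃ λ m → ∃ λ (𝓗 : Family n m) →
  IsRefinedRefiner (2 * q) q X R 𝓗 × LeTimesMaxDegLog (2 * q) m X

omniAbsorberAndRefiner : ∀ h (G X : Subset (suc n)) → suc h * ∣ X ∣ ≤ ∣ G ─ X ∣ →
                         OmniAbsorberIn (suc h) G X × RefinerIn (suc h) G X
omniAbsorberAndRefiner h G X room =
  (A , A⊆G , T + T , 𝓗 , isRefinedOmniAbsorber , inj₁ ∣A∣≤2qk) ,
  (A , A⊆G , T + T , 𝓗 , isRefinedRefiner , inj₁ T+T≤2qk)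
  where open Realisation.Construction h G X (enumerationLabelling h G X room)

-- With no vertex at all there is no default label, so this case is settled directly.
omniAbsorberAndRefiner₀ : ∀ q → OmniAbsorberIn {0} q [] [] × RefinerIn {0} q [] []
omniAbsorberAndRefiner₀ q =
  ([] , (λ ()) , 0 , (λ ()) , ((disjoint , (λ ()) , decomposition) , (λ ())) , inj₁ z≤n) ,
  ([] , (λ ()) , 0 , (λ ()) , ((disjoint , (λ ()) , decomposition) , (λ ()) , (λ ())) , inj₁ z≤n)
  where
  disjoint : EdgeDisjoint {0} [] []
  disjoint (() , _)
  decomposition : ∀ L → L ⊆ [] → q ∣ ∣ L ∣ → ∃ λ S → DecomposesAs {0} (λ ()) S (L ∪ [])
  decomposition _ _ _ = [] , (λ ()) , (λ ())

room-outside-X : ∀ {q n g x} → 2 ≤ q → 3 * n ≤ 4 * g → 2 * q * x ≤ n → q * x + x ≤ g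
room-outside-X {q} {n} {g} {x} 2≤q 3n≤4g 2qx≤n = *-cancelˡ-≤ 4 (begin
  4 * (q * x + x)           ≡⟨ solve 2 (λ q x → con 4 :* (q :* x :+ x)
                                                := con 4 :* (q :* x) :+ con 2 :* (con 2 :* x)) refl q x ⟩
  4 * (q * x) + 2 * (2 * x) ≤⟨ +-monoʳ-≤ (4 * (q * x)) (*-monoʳ-≤ 2 (*-monoˡ-≤ x 2≤q)) ⟩
  4 * (q * x) + 2 * (q * x) ≡⟨ solve 2 (λ q x → con 4 :* (q :* x) :+ con 2 :* (q :* x)
                                                := con 3 :* (con 2 :* q :* x)) refl q x ⟩
  3 * (2 * q * x)           ≤⟨ *-monoʳ-≤ 3 2qx≤n ⟩
  3 * n                     ≤⟨ 3n≤4g ⟩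
  4 * g                     ∎)
  where
  open ≤-Reasoning
  open +-*-Solver

corollary2p5 : (q : ℕ) → 2 ≤ q →
    -- ε = a / b ∈ (0,1) (a rational ε is w.l.o.g., see NOTES)
    ∃ λ a → ∃ λ b → 0 < a × a < b ×
    ((n : ℕ) (G X : Hyp1 n) →
      -- δ(G) ≥ (1 - ε) n
      (b ∸ a) * n ≤ b * δ₁ G →
      X ⊆ G →
      -- Δ(X) ≤ n / C with C = 2q
      (2 * q) * Δ₁ X ≤ n →
      (∃ λ (A : Hyp1 n) → A ⊆ G × ∃ λ m → ∃ λ (𝓗 : Family n m) →
          IsRefinedOmniAbsorber (2 * q) q X A 𝓗 ×
          LeTimesMaxDegLog (2 * q) (Δ₁ A) X) ×
      (∃ λ (R : Hyp1 n) → R ⊆ G × ∃ λ m → ∃ λ (𝓗 : Family n m) →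
          IsRefinedRefiner (2 * q) q X R 𝓗 ×
          LeTimesMaxDegLog (2 * q) m X))
-- ε = 1/4.
corollary2p5 (suc h) 2≤q = 1 , 4 , s≤s z≤n , s≤s (s≤s z≤n) , absorbers
  where
  absorbers : (n : ℕ) (G X : Hyp1 n) → 3 * n ≤ 4 * δ₁ G → X ⊆ G → 2 * suc h * Δ₁ X ≤ n →
              OmniAbsorberIn (suc h) G X × RefinerIn (suc h) G X
  absorbers zero    [] [] _ _ _ = omniAbsorberAndRefiner₀ (suc h)
  absorbers (suc n) G  X  3n≤4∣G∣ _ 2q∣X∣≤n = omniAbsorberAndRefiner h G X
    (+-cancelʳ-≤ ∣ X ∣ _ _ (≤-trans (room-outside-X 2≤q 3n≤4∣G∣ 2q∣X∣≤n) (∣p∣≤∣p─q∣+∣q∣ G X)))
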